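{- Let $(W,S)$ and $(W',S')$ be finite Coxeter systems, let $\eta:W\to W'$ be a surjective lattice homomorphism between the weak orders, and let $J=\{s\in S:\eta(s)\neq 1'\}$, where $1'$ is the identity element of $W'$. Then $\eta$ factors as $\eta=\eta|_{W_J}\circ\eta_J$, where $\eta_J:W\to W_J$ is the parabolic homomorphism and $\eta|_{W_J}$ is the restriction of $\eta$ to $W_J$. The map $\eta|_{W_J}:W_J\to W'$ is a compressive homomorphism.
   Context: For a finite Coxeter system $(W,S)$ with length function $\ell$, the (right) weak order on $W$ is the lattice whose cover relations are $w\lessdot ws$ for $w\in W$, $s\in S$ with $\ell(w)<\ell(ws)$. A lattice homomorphism preserves pairwise meets and joins. For $J\subseteq S$, $W_J$ is the standard parabolic subgroup generated by $J$, with its own weak order (it is a lower interval in $W$). Every $w\in W$ has a unique factorization $w=w_J\cdot {}^Jw$ maximizing $\ell(w_J)$ subject to $\ell(w_J)+\ell({}^Jw)=\ell(w)$ and $w_J\in W_J$; the parabolic homomorphism is the map $\eta_J:W\to W_J$, $w\mapsto w_J$. An atom of a finite lattice is an element covering the minimum element (the atoms of the weak order on $W$ are the elements of $S$). A homomorphism of finite lattices is compressive if it is surjective and restricts to a bijection between the sets of atoms of the two lattices. -}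

module Defs where

open import Level using (Level; _⊔_) renaming (suc to lsuc)
open import Algebra.Bundles using (Group)
import Algebra.Properties.Group as GroupProperties
open import Data.Empty using (⊥-elim)
open import Data.Fin using (Fin)
open import Data.Fin.Properties using (any?)
open import Data.List using (List; []; _∷_; _++_; length; foldr; replicate; concat; reverse; lookup; filter; allFin)
open import Data.List.Properties using (unfold-reverse)
open import Data.List.Membership.Propositional using (_∈_)
open import Data.List.Membership.Propositional.Properties using (∈-lookup)
open import Data.List.Relation.Unary.All using (All; []; _∷_)
open import Data.List.Relation.Unary.All.Properties using (++⁺)
open import Data.List.Relation.Unary.Any using (index)
open import Data.List.Relation.Unary.Any.Properties using (lookup-index)
open import Data.Nat using (ℕ; zero; suc; _+_; _<_; z≤n)
import Data.Nat as ℕ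
open import Data.Nat.Divisibility using (_∣_)
import Data.Nat.Properties as ℕ
open import Data.Product using (Σ; ∃; ∃₂; _×_; _,_; proj₁; proj₂)
open import Data.Sum using (_⊎_; inj₁; inj₂)
open import Function.Bundles using (Inverse; _⇔_)
open import Function.Definitions using (Congruent; Surjective)
open import Relation.Binary.Bundles using (Poset)
open import Relation.Binary.Definitions using (Decidable; Minimum)
import Relation.Binary.Construct.NonStrictToStrict as Strict
open import Relation.Binary.PropositionalEquality as ≡ using (_≡_)
open import Relation.Nullary using (¬_; Dec; yes; no)
open import Relation.Nullary.Decidable using (map′; ¬?)

module _ {c ℓ₁ ℓ₂} (P : Poset c ℓ₁ ℓ₂) where
  open Poset P
  open Strict _≈_ _≤_ using () renaming (_<_ to _≺_)

  record IsMeet (x y z : Carrier) : Set (c ⊔ ℓ₂) where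
    field
      lowerˡ   : z ≤ x
      lowerʳ   : z ≤ y
      greatest : ∀ w → w ≤ x → w ≤ y → w ≤ z

  record IsJoin (x y z : Carrier) : Set (c ⊔ ℓ₂) where
    field
      upperˡ : x ≤ z
      upperʳ : y ≤ z
      least  : ∀ w → x ≤ w → y ≤ w → z ≤ w

  Covers : Carrier → Carrier → Set (c ⊔ ℓ₁ ⊔ ℓ₂)
  Covers y x = x ≺ y × (∀ z → ¬ (x ≺ z × z ≺ y))

  IsAtom : Carrier → Set (c ⊔ ℓ₁ ⊔ ℓ₂)
  IsAtom a = ∃ λ ⊥ → Minimum _≤_ ⊥ × Covers a ⊥

module _ {c ℓ₁ ℓ₂ c′ ℓ₁′ ℓ₂′}
         (P : Poset c ℓ₁ ℓ₂) (Q : Poset c′ ℓ₁′ ℓ₂′) where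
  private
    module P = Poset P
    module Q = Poset Q

  -- Meets and joins are unique up to _≈_, so for lattices P and Q the fields
  -- ∧-homo and ∨-homo say exactly f (x ∧ y) ≈ f x ∧ f y and
  -- f (x ∨ y) ≈ f x ∨ f y, without chosen meet and join operations.
  record IsLatticeHomomorphism (f : P.Carrier → Q.Carrier)
         : Set (c ⊔ ℓ₁ ⊔ ℓ₂ ⊔ c′ ⊔ ℓ₁′ ⊔ ℓ₂′) where
    field
      cong   : Congruent P._≈_ Q._≈_ f
      ∧-homo : ∀ {x y z} → IsMeet P x y z → IsMeet Q (f x) (f y) (f z)
      ∨-homo : ∀ {x y z} → IsJoin P x y z → IsJoin Q (f x) (f y) (f z)

  record IsCompressive (f : P.Carrier → Q.Carrier)
         : Set (c ⊔ ℓ₁ ⊔ ℓ₂ ⊔ c′ ⊔ ℓ₁′ ⊔ ℓ₂′) where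
    field
      isLatticeHomomorphism : IsLatticeHomomorphism f
      surjective            : Surjective P._≈_ Q._≈_ f
      atom                  : ∀ {a} → IsAtom P a → IsAtom Q (f a)
      atom-injective        : ∀ {a b} → IsAtom P a → IsAtom P b →
                              f a Q.≈ f b → a P.≈ b
      atom-surjective       : ∀ {b} → IsAtom Q b →
                              ∃ λ a → IsAtom P a × f a Q.≈ b

-- Groups generated by a finite family of elements of square 1.  This common
-- generality lets a parabolic subgroup W_J carry its own length function and
-- its own weak order, computed from its own generators.  Decidable equality,
-- automatic for a finite group, makes the length a computable function.

record GeneratedGroup c ℓ : Set (lsuc (c ⊔ ℓ)) where
  field
    group : Group c ℓ
  open Group group public
  field
    _≟_            : Decidable _≈_
    rank           : ℕ
    gen            : Fin rank → Carrier
    gen-involutive : ∀ s → gen s ∙ gen s ≈ ε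

  Word : Set
  Word = List (Fin rank)

  eval : Word → Carrier
  eval = foldr (λ s w → gen s ∙ w) ε

  field
    generates : ∀ w → ∃ λ u → eval u ≈ w

  open GroupProperties group using (⁻¹-anti-homo-∙; ε⁻¹≈ε; inverseʳ-unique)

  eval-++ : ∀ u v → eval (u ++ v) ≈ eval u ∙ eval v
  eval-++ []      v = sym (identityˡ (eval v))
  eval-++ (s ∷ u) v = trans (∙-congˡ (eval-++ u v)) (sym (assoc _ _ _))

  eval-reverse : ∀ u → eval (reverse u) ≈ eval u ⁻¹
  eval-reverse []      = sym ε⁻¹≈ε
  eval-reverse (s ∷ u) rewrite unfold-reverse s u =
    trans (eval-++ (reverse u) (s ∷ []))
      (trans (∙-cong (eval-reverse u)
               (trans (identityʳ _) (inverseʳ-unique _ _ (gen-involutive s))))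
             (sym (⁻¹-anti-homo-∙ _ _)))

  private
    ofLength? : ∀ k w → Dec (∃ λ u → length u ≡ k × eval u ≈ w)
    ofLength? zero w =
      map′ (λ e → [] , ≡.refl , e) (λ where ([] , _ , e) → e) (ε ≟ w)
    ofLength? (suc k) w = map′ to from (any? λ s → ofLength? k (gen s ⁻¹ ∙ w))
      where
      open GroupProperties group using (\\-leftDividesˡ; \\-leftDividesʳ)
      to : _ → ∃ λ u → length u ≡ suc k × eval u ≈ w
      to (s , u , l , e) =
        s ∷ u , ≡.cong suc l , trans (∙-congˡ e) (\\-leftDividesˡ (gen s) w)
      from : (∃ λ u → length u ≡ suc k × eval u ≈ w) → _
      from (s ∷ u , l , e) =
        s , u , ℕ.suc-injective l ,
        trans (sym (\\-leftDividesʳ (gen s) (eval u))) (∙-congˡ e)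

  IsReducedWordFor : Carrier → Word → Set ℓ
  IsReducedWordFor w u =
    eval u ≈ w × (∀ v → eval v ≈ w → length u ℕ.≤ length v)

  private
    search : ∀ w k → ∃ (IsReducedWordFor w)
                   ⊎ (∀ v → eval v ≈ w → k ℕ.≤ length v)
    search w zero    = inj₂ λ _ _ → z≤n
    search w (suc k) with search w k
    ... | inj₁ r = inj₁ r
    ... | inj₂ b with ofLength? k w
    ...   | yes (u , ≡.refl , e) = inj₁ (u , e , b)
    ...   | no ¬u = inj₂ λ v e →
            ℕ.≤∧≢⇒< (b v e) (λ k≡ → ¬u (v , ≡.sym k≡ , e))

  reducedWord : ∀ w → ∃ (IsReducedWordFor w)
  reducedWord w with generates w
  ... | u , e with search w (suc (length u))
  ...   | inj₁ r = r
  ...   | inj₂ b = ⊥-elim (ℕ.1+n≰n (b u e))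

  len : Carrier → ℕ
  len w = length (proj₁ (reducedWord w))

  len-cong : ∀ {w x} → w ≈ x → len w ≡ len x
  len-cong {w} {x} w≈x with reducedWord w | reducedWord x
  ... | u , e , b | v , f , d =
    ℕ.≤-antisym (b v (trans f (sym w≈x))) (d u (trans e w≈x))

  _⋖_ : Carrier → Carrier → Set ℓ
  w ⋖ x = ∃ λ s → x ≈ w ∙ gen s × len w < len x

  data _≤_ : Carrier → Carrier → Set (c ⊔ ℓ) where
    ≤-equal : ∀ {w x} → w ≈ x → w ≤ x
    ≤-step  : ∀ {w x y} → w ⋖ x → x ≤ y → w ≤ y

  ≤-respˡ : ∀ {w x y} → w ≈ x → x ≤ y → w ≤ y
  ≤-respˡ w≈x (≤-equal x≈y) = ≤-equal (trans w≈x x≈y)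
  ≤-respˡ w≈x (≤-step (s , e , l) x≤y) =
    ≤-step (s , trans e (∙-congʳ (sym w≈x)) ,
          ≡.subst (ℕ._< _) (len-cong (sym w≈x)) l) x≤y

  ≤-trans : ∀ {w x y} → w ≤ x → x ≤ y → w ≤ y
  ≤-trans (≤-equal w≈x) x≤y = ≤-respˡ w≈x x≤y
  ≤-trans (≤-step c w≤x)    x≤y = ≤-step c (≤-trans w≤x x≤y)

  ≤⇒len≤ : ∀ {w x} → w ≤ x → len w ℕ.≤ len x
  ≤⇒len≤ (≤-equal w≈x) = ℕ.≤-reflexive (len-cong w≈x)
  ≤⇒len≤ (≤-step (_ , _ , l) x≤y) = ℕ.<⇒≤ (ℕ.<-≤-trans l (≤⇒len≤ x≤y))

  ≤-antisym : ∀ {w x} → w ≤ x → x ≤ w → w ≈ x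
  ≤-antisym (≤-equal w≈x) _ = w≈x
  ≤-antisym (≤-step (_ , _ , l) y≤x) x≤w =
    ⊥-elim (ℕ.<⇒≱ (ℕ.<-≤-trans l (≤⇒len≤ y≤x)) (≤⇒len≤ x≤w))

  weakOrder : Poset c ℓ (c ⊔ ℓ)
  weakOrder = record
    { Carrier        = Carrier
    ; _≈_            = _≈_
    ; _≤_            = _≤_
    ; isPartialOrder = record
      { isPreorder = record
        { isEquivalence = isEquivalence
        ; reflexive     = ≤-equal
        ; trans         = ≤-trans
        }
      ; antisym    = ≤-antisym
      }
    }

-- The congruence on words generated by (s t)^(m s t) ~ 1.  Words in the
-- generators alone suffice to present a group here: in a Coxeter system
-- m s s = 1, so s s ~ 1 and every letter is its own inverse.
module _ {n : ℕ} where

  power : Fin n → Fin n → ℕ → List (Fin n)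
  power s t k = concat (replicate k (s ∷ t ∷ []))

  data _⊢_~_ (m : Fin n → Fin n → ℕ) : List (Fin n) → List (Fin n) → Set where
    ~-refl   : ∀ {u} → m ⊢ u ~ u
    ~-sym    : ∀ {u v} → m ⊢ u ~ v → m ⊢ v ~ u
    ~-trans  : ∀ {u v w} → m ⊢ u ~ v → m ⊢ v ~ w → m ⊢ u ~ w
    ~-++     : ∀ {u u′ v v′} → m ⊢ u ~ u′ → m ⊢ v ~ v′ → m ⊢ (u ++ v) ~ (u′ ++ v′)
    relation : ∀ s t → m ⊢ power s t (m s t) ~ []

-- (W , S) with S a set of involutions generating W, presented by the relations
-- (s t)^(m s t) = 1, where m s t is the order of s t.  The set S ⊆ W is
-- enumerated without repetition by gen.
record FiniteCoxeterSystem c ℓ : Set (lsuc (c ⊔ ℓ)) where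
  field
    generatedGroup : GeneratedGroup c ℓ
  open GeneratedGroup generatedGroup public
  field
    finite         : ∃ λ N → Inverse setoid (≡.setoid (Fin N))
    gen-injective  : ∀ {s t} → gen s ≈ gen t → s ≡ t
    gen-nontrivial : ∀ s → ¬ (gen s ≈ ε)
    m              : Fin rank → Fin rank → ℕ
    m-order        : ∀ s t k → eval (power s t k) ≈ ε ⇔ m s t ∣ k
    presentation   : ∀ u v → eval u ≈ eval v → m ⊢ u ~ v

module _ {c ℓ} (W : GeneratedGroup c ℓ) where
  open GeneratedGroup W

  -- The subset J of the generators is given by a list of its elements.
  _∈⟨_⟩ : Carrier → List (Fin rank) → Set ℓ
  w ∈⟨ J ⟩ = ∃ λ u → All (_∈ J) u × eval u ≈ w

  parabolic : List (Fin rank) → GeneratedGroup (c ⊔ ℓ) ℓ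
  parabolic J = record
    { group = record
      { Carrier = Σ Carrier (_∈⟨ J ⟩)
      ; _≈_     = λ v w → proj₁ v ≈ proj₁ w
      ; _∙_     = λ where
          (v , a , a∈J , e) (w , b , b∈J , f) →
            v ∙ w , a ++ b , ++⁺ a∈J b∈J , trans (eval-++ a b) (∙-cong e f)
      ; ε       = ε , [] , [] , refl
      ; _⁻¹     = λ where
          (v , a , a∈J , e) →
            v ⁻¹ , reverse a , All-reverse a∈J , trans (eval-reverse a) (⁻¹-cong e)
      ; isGroup = record
        { isMonoid = record
          { isSemigroup = record
            { isMagma = record
              { isEquivalence = record
                { refl  = refl
                ; sym   = sym
                ; trans = trans
                }
              ; ∙-cong = ∙-cong
              }
            ; assoc = λ x y z → assoc (proj₁ x) (proj₁ y) (proj₁ z)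
            }
          ; identity = (λ x → identityˡ (proj₁ x)) , (λ x → identityʳ (proj₁ x))
          }
        ; inverse = (λ x → inverseˡ (proj₁ x)) , (λ x → inverseʳ (proj₁ x))
        ; ⁻¹-cong = ⁻¹-cong
        }
      }
    ; _≟_            = λ v w → proj₁ v ≟ proj₁ w
    ; rank           = length J
    ; gen            = λ i → gen (lookup J i) , lookup J i ∷ [] ,
                             ∈-lookup i ∷ [] , identityʳ _
    ; gen-involutive = λ i → gen-involutive (lookup J i)
    ; generates      = λ where
        (w , u , u∈J , e) → indices u∈J , trans (eval-indices u∈J) e
    }
    where
    All-reverse : ∀ {u} → All (_∈ J) u → All (_∈ J) (reverse u)
    All-reverse []                    = []
    All-reverse {s ∷ u} (s∈J ∷ u∈J)
      rewrite unfold-reverse s u = ++⁺ (All-reverse u∈J) (s∈J ∷ [])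

    indices : ∀ {u} → All (_∈ J) u → List (Fin (length J))
    indices []        = []
    indices (p ∷ u∈J) = index p ∷ indices u∈J

    eval-indices : ∀ {u} (u∈J : All (_∈ J) u) →
                   proj₁ (foldr _ _ (indices u∈J)) ≈ eval u
    eval-indices []        = refl
    eval-indices (p ∷ u∈J) =
      ∙-cong (Group.reflexive group (≡.cong gen (≡.sym (lookup-index p))))
             (eval-indices u∈J)

  record IsFactorization (J : List (Fin rank)) (w v x : Carrier) : Set ℓ where
    field
      inParabolic : v ∈⟨ J ⟩
      product     : v ∙ x ≈ w
      additive    : len v + len x ≡ len w

  -- v is the W_J-part w_J of w.
  IsParabolicPart : List (Fin rank) → Carrier → Carrier → Set (c ⊔ ℓ)
  IsParabolicPart J w v = ∃ λ x → IsFactorization J w v x ×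
    (∀ v′ x′ → IsFactorization J w v′ x′ → len v′ ℕ.≤ len v)

  IsParabolicMap : (J : List (Fin rank)) →
                   (Carrier → GeneratedGroup.Carrier (parabolic J)) → Set (c ⊔ ℓ)
  IsParabolicMap J η = ∀ w → IsParabolicPart J w (proj₁ (η w))

  restrict : ∀ {a} {A : Set a} (J : List (Fin rank)) →
             (Carrier → A) → GeneratedGroup.Carrier (parabolic J) → A
  restrict J f v = f (proj₁ v)

module _ {c ℓ c′ ℓ′} (W : GeneratedGroup c ℓ) (W′ : GeneratedGroup c′ ℓ′) where
  private
    module W  = GeneratedGroup W
    module W′ = GeneratedGroup W′

  nontrivialGens : (W.Carrier → W′.Carrier) → List (Fin W.rank)
  nontrivialGens η = filter (λ s → ¬? (η (W.gen s) W′.≟ W′.ε)) (allFin W.rank)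

{-# OPTIONS --safe #-}
module Submission where

-- The W_J-part of w is the meet of w with the longest element w₀(J) of W_J.
-- Since w₀(K) is the join of K, and η kills the generators outside J, η sends
-- w₀(J) to the same element as the longest element of W, which is the top of W′
-- by surjectivity.  Hence η(w_J) = η(w) ∧ η(w₀(J)) = η(w).
-- An atom s ∈ J meets every element in 1 or s, so below η(s) there is nothing
-- but 1′ and η(s), and distinct s, t ∈ J have η(s) ∧ η(t) = 1′.
--
-- The Coxeter-theoretic input is the exchange condition.  It comes from the
-- parity with which a path in the Cayley graph crosses a wall: this parity is
-- unchanged by the defining relations.

open import Defs
open import Level using (_⊔_)
import Algebra.Properties.Group as GroupProperties
open import Data.Bool using (Bool; true; false; _xor_)
open import Data.Bool.Properties using (xor-assoc; xor-same)
open import Data.Empty using (⊥; ⊥-elim)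
open import Data.Fin using (Fin; zero; suc)
open import Data.List using (List; []; _∷_; _++_; length; map; lookup; allFin)
open import Data.List.Membership.Propositional using (_∈_; find; lose)
open import Data.List.Membership.Propositional.Properties
  using (∈-filter⁺; ∈-filter⁻; ∈-allFin; ∈-lookup)
open import Data.List.Properties using (length-++; length-map)
open import Data.List.Relation.Unary.All as All using (All; []; _∷_)
open import Data.List.Relation.Unary.Any using (any?; here; there; index)
open import Data.List.Relation.Unary.Any.Properties using (lookup-index)
open import Data.Nat using (ℕ; zero; suc; _+_; z≤n; s≤s)
import Data.Nat as ℕ
open import Data.Nat.Divisibility using (∣-refl)
import Data.Nat.Properties as ℕ
open import Data.Product using (∃; _×_; _,_; proj₁; proj₂)
open import Data.Sum using (_⊎_; inj₁; inj₂)
open import Function.Bundles using (Equivalence; Inverse; mk⇔)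
open import Function.Definitions using (Surjective)
open import Relation.Binary.PropositionalEquality as ≡ using (_≡_)
import Relation.Binary.Reasoning.Setoid as SetoidReasoning
open import Relation.Nullary using (¬_; yes; no)
open import Relation.Nullary.Decidable using (does; does-⇔; dec-true; ¬?)

-- Length, weak order and atoms in a group generated by involutions.

module Length {c ℓ} (W : GeneratedGroup c ℓ) where
  open GeneratedGroup W

  word : Carrier → Word
  word w = proj₁ (reducedWord w)

  eval-word : ∀ w → eval (word w) ≈ w
  eval-word w = proj₁ (proj₂ (reducedWord w))

  len-≤-length : ∀ u {w} → eval u ≈ w → len w ℕ.≤ length u
  len-≤-length u {w} = proj₂ (proj₂ (reducedWord w)) u

  len-ε : len ε ≡ 0
  len-ε = ℕ.n≤0⇒n≡0 (len-≤-length [] refl)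

  len≤0⇒≈ε : ∀ {w} → len w ℕ.≤ 0 → w ≈ ε
  len≤0⇒≈ε {w} l with reducedWord w
  ... | [] , e , _ = sym e

  len-gen : ∀ s → len (gen s) ℕ.≤ 1
  len-gen s = len-≤-length (s ∷ []) (identityʳ _)

  len-gen∙ : ∀ s w → len (gen s ∙ w) ℕ.≤ suc (len w)
  len-gen∙ s w = len-≤-length (s ∷ word w) (∙-congˡ (eval-word w))

  len-∙-length : ∀ w u → len (w ∙ eval u) ℕ.≤ len w + length u
  len-∙-length w u = ℕ.≤-trans
    (len-≤-length (word w ++ u) (trans (eval-++ (word w) u) (∙-congʳ (eval-word w))))
    (ℕ.≤-reflexive (length-++ (word w)))

  len-∙ : ∀ v w → len (v ∙ w) ℕ.≤ len v + len w
  len-∙ v w = ℕ.≤-trans (ℕ.≤-reflexive (len-cong (∙-congˡ (sym (eval-word w)))))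
                        (len-∙-length v (word w))

  len-∙gen : ∀ w s → len (w ∙ gen s) ℕ.≤ suc (len w)
  len-∙gen w s = ℕ.≤-trans (len-∙ w (gen s))
    (ℕ.≤-trans (ℕ.+-monoʳ-≤ (len w) (len-gen s)) (ℕ.≤-reflexive (ℕ.+-comm (len w) 1)))

  gen-cancel : ∀ s w → gen s ∙ (gen s ∙ w) ≈ w
  gen-cancel s w =
    trans (sym (assoc _ _ _)) (trans (∙-congʳ (gen-involutive s)) (identityˡ w))

  gen-cancelʳ : ∀ w s → (w ∙ gen s) ∙ gen s ≈ w
  gen-cancelʳ w s =
    trans (assoc _ _ _) (trans (∙-congˡ (gen-involutive s)) (identityʳ w))

  ≤-respʳ : ∀ {w x y} → x ≈ y → w ≤ x → w ≤ y
  ≤-respʳ x≈y w≤x = ≤-trans w≤x (≤-equal x≈y)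

  -- A letter raises the length by at most one, so reaching the full sum forces every letter of `u`
  -- to ascend.
  length-additive⇒≤ : ∀ w u → len w + length u ℕ.≤ len (w ∙ eval u) → w ≤ (w ∙ eval u)
  length-additive⇒≤ w []      _ = ≤-equal (sym (identityʳ w))
  length-additive⇒≤ w (s ∷ u) l =
    ≤-step (s , refl , up) (≤-respʳ assoc′ (length-additive⇒≤ (w ∙ gen s) u
      (ℕ.≤-trans (ℕ.+-monoˡ-≤ (length u) (len-∙gen w s)) l′)))
    where
    assoc′ = assoc w (gen s) (eval u)
    l′ : suc (len w + length u) ℕ.≤ len ((w ∙ gen s) ∙ eval u)
    l′ = ℕ.≤-trans (ℕ.≤-reflexive (≡.sym (ℕ.+-suc (len w) (length u))))
           (ℕ.≤-trans l (ℕ.≤-reflexive (len-cong (sym assoc′))))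
    up : len w ℕ.< len (w ∙ gen s)
    up = ℕ.+-cancelʳ-≤ (length u) _ _ (ℕ.≤-trans l′ (len-∙-length (w ∙ gen s) u))

  -- With `≤⇒additive`, this identifies the weak order with the prefix order, the form in which
  -- later arguments use it.
  additive⇒≤ : ∀ {w x} y → w ∙ y ≈ x → len w + len y ℕ.≤ len x → w ≤ x
  additive⇒≤ {w} y e l = ≤-respʳ wy≈x (length-additive⇒≤ w (word y)
    (ℕ.≤-trans l (ℕ.≤-reflexive (len-cong (sym wy≈x)))))
    where wy≈x = trans (∙-congˡ (eval-word y)) e

  ≤⇒additive : ∀ {w x} → w ≤ x → ∃ λ y → w ∙ y ≈ x × len w + len y ℕ.≤ len x
  ≤⇒additive (≤-equal w≈x) = ε , trans (identityʳ _) w≈x ,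
    ℕ.≤-reflexive (≡.trans (≡.cong (len _ +_) len-ε)
                           (≡.trans (ℕ.+-identityʳ _) (len-cong w≈x)))
  ≤⇒additive {w} (≤-step {x = x} (s , e , l) x≤z) with ≤⇒additive x≤z
  ... | y , xy≈z , l′ = gen s ∙ y ,
    trans (sym (assoc _ _ _)) (trans (∙-congʳ (sym e)) xy≈z) ,
    ℕ.≤-trans (ℕ.+-monoʳ-≤ (len w) (len-gen∙ s y))
      (ℕ.≤-trans (ℕ.≤-reflexive (ℕ.+-suc (len w) (len y)))
        (ℕ.≤-trans (ℕ.+-monoˡ-≤ (len y) l) l′))

  ε-minimum : ∀ w → ε ≤ w
  ε-minimum w = additive⇒≤ w (identityˡ w)
    (ℕ.≤-reflexive (≡.cong (_+ len w) len-ε))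

  ≤ε⇒≈ε : ∀ {w} → w ≤ ε → w ≈ ε
  ≤ε⇒≈ε w≤ε = ≤-antisym w≤ε (ε-minimum _)

  ≤gen⇒ : ∀ {z s} → z ≤ gen s → z ≈ ε ⊎ z ≈ gen s
  ≤gen⇒ (≤-equal e) = inj₂ e
  ≤gen⇒ {z} {s} (≤-step (_ , _ , l) x≤s) = inj₁ (len≤0⇒≈ε
    (ℕ.≤-pred (ℕ.≤-trans (ℕ.<-≤-trans l (≤⇒len≤ x≤s)) (len-gen s))))

  gen-isAtom : ∀ {a} s → a ≈ gen s → ¬ (a ≈ ε) → IsAtom weakOrder a
  gen-isAtom s a≈s a≉ε = ε , ε-minimum , (ε-minimum _ , λ e → a≉ε (sym e)) , between
    where
    between : ∀ z → _
    between z ((_ , ε≉z) , (z≤a , z≉a)) with ≤gen⇒ (≤-respʳ a≈s z≤a)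
    ... | inj₁ z≈ε = ε≉z (sym z≈ε)
    ... | inj₂ z≈s = z≉a (trans z≈s (sym a≈s))

  -- The first cover on a chain from the minimum to `a` must already reach `a`.
  atom⇒gen : ∀ {a} → IsAtom weakOrder a → ∃ λ s → a ≈ gen s
  atom⇒gen {a} (o , o-min , (o≤a , o≉a) , between) with o≤a
  ... | ≤-equal o≈a = ⊥-elim (o≉a o≈a)
  ... | ≤-step {x = x} (s , e , l) x≤a with x ≟ a
  ...   | yes x≈a = s , trans (sym x≈a)
          (trans e (trans (∙-congʳ (≤ε⇒≈ε (o-min ε))) (identityˡ _)))
  ...   | no x≉a = ⊥-elim (between x
          ( (≤-step (s , e , l) (≤-equal refl) ,
             λ o≈x → ℕ.<-irrefl (len-cong o≈x) l)
          , (x≤a , x≉a)))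

  atom-nontrivial : ∀ {a} → IsAtom weakOrder a → ¬ (a ≈ ε)
  atom-nontrivial (o , o-min , (_ , o≉a) , _) a≈ε =
    o≉a (trans (≤ε⇒≈ε (o-min ε)) (sym a≈ε))

-- Parity of wall crossings in the Cayley graph.

module Crossing {c ℓ} (𝒲 : FiniteCoxeterSystem c ℓ) where
  open FiniteCoxeterSystem 𝒲
  open Length generatedGroup
  open GroupProperties group using (∙-cancelˡ; ∙-cancelʳ)
  open SetoidReasoning setoid

  δ : Carrier → Carrier → Bool
  δ a b = does (a ≟ b)

  δ-shiftˡ : ∀ g {a b a′ b′} → g ∙ a ≈ a′ → g ∙ b ≈ b′ → δ a b ≡ δ a′ b′
  δ-shiftˡ g {a} {b} ga≈ gb≈ = does-⇔
    (mk⇔ (λ e → trans (sym ga≈) (trans (∙-congˡ e) gb≈))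
         (λ e → ∙-cancelˡ g a b (trans ga≈ (trans e (sym gb≈))))) (_ ≟ _) (_ ≟ _)

  δ-shiftʳ : ∀ g {a b a′ b′} → a ∙ g ≈ a′ → b ∙ g ≈ b′ → δ a b ≡ δ a′ b′
  δ-shiftʳ g {a} {b} ag≈ bg≈ = does-⇔
    (mk⇔ (λ e → trans (sym ag≈) (trans (∙-congʳ e) bg≈))
         (λ e → ∙-cancelʳ g a b (trans ag≈ (trans e (sym bg≈))))) (_ ≟ _) (_ ≟ _)

  δ-cong : ∀ {a b a′ b′} → a ≈ a′ → b ≈ b′ → δ a b ≡ δ a′ b′
  δ-cong a≈ b≈ = δ-shiftˡ ε (trans (identityˡ _) a≈) (trans (identityˡ _) b≈)

  -- The parity of the number of edges inverted by left multiplication by t on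
  -- the path labelled u from p in the Cayley graph.
  cross : Carrier → Word → Carrier → Bool
  cross t []      p = false
  cross t (s ∷ u) p = δ (t ∙ p) (p ∙ gen s) xor cross t u (p ∙ gen s)

  cross-cong : ∀ t u {p q} → p ≈ q → cross t u p ≡ cross t u q
  cross-cong t []      p≈q = ≡.refl
  cross-cong t (s ∷ u) p≈q =
    ≡.cong₂ _xor_ (δ-cong (∙-congˡ p≈q) (∙-congʳ p≈q)) (cross-cong t u (∙-congʳ p≈q))

  cross-++ : ∀ t u v p → cross t (u ++ v) p ≡ cross t u p xor cross t v (p ∙ eval u)
  cross-++ t []      v p = cross-cong t v (sym (identityʳ p))
  cross-++ t (s ∷ u) v p = ≡.trans
    (≡.cong (d xor_) (≡.trans (cross-++ t u v (p ∙ gen s))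
      (≡.cong (cross t u (p ∙ gen s) xor_) (cross-cong t v (assoc _ _ _)))))
    (≡.sym (xor-assoc d _ _))
    where d = δ (t ∙ p) (p ∙ gen s)

  -- Left translation by an element commuting with `t` does not change whether an edge is inverted
  -- by `t`.
  cross-centraliser : ∀ t g u p → t ∙ g ≈ g ∙ t → cross t u (g ∙ p) ≡ cross t u p
  cross-centraliser t g []      p tg≈gt = ≡.refl
  cross-centraliser t g (s ∷ u) p tg≈gt = ≡.cong₂ _xor_
    (≡.sym (δ-shiftˡ g (trans (sym (assoc _ _ _)) (trans (∙-congʳ (sym tg≈gt)) (assoc _ _ _)))
                       (sym (assoc _ _ _))))
    (≡.trans (cross-cong t u (assoc _ _ _)) (cross-centraliser t g u (p ∙ gen s) tg≈gt))

  ⊕ : ℕ → (ℕ → Bool) → Bool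
  ⊕ zero    f = false
  ⊕ (suc n) f = f 0 xor ⊕ n (λ j → f (suc j))

  ⊕-cong : ∀ n {f g} → (∀ j → f j ≡ g j) → ⊕ n f ≡ ⊕ n g
  ⊕-cong zero    f≡g = ≡.refl
  ⊕-cong (suc n) f≡g = ≡.cong₂ _xor_ (f≡g 0) (⊕-cong n (λ j → f≡g (suc j)))

  ⊕-+ : ∀ k n f → ⊕ (k + n) f ≡ ⊕ k f xor ⊕ n (λ j → f (k + j))
  ⊕-+ zero    n f = ≡.refl
  ⊕-+ (suc k) n f = ≡.trans (≡.cong (f 0 xor_) (⊕-+ k n (λ j → f (suc j))))
                            (≡.sym (xor-assoc (f 0) _ _))

  module _ (s t : Fin rank) where
    private
      r : ℕ → Carrier
      r k = eval (power s t k)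

      st = gen s ∙ gen t

    r-suc : ∀ k → r (suc k) ≈ st ∙ r k
    r-suc k = sym (assoc _ _ _)

    r-+ : ∀ k j → r (k + j) ≈ r k ∙ r j
    r-+ zero    j = sym (identityˡ _)
    r-+ (suc k) j = begin
      r (suc (k + j))      ≈⟨ r-suc (k + j) ⟩
      st ∙ r (k + j)       ≈⟨ ∙-congˡ (r-+ k j) ⟩
      st ∙ (r k ∙ r j)     ≈⟨ assoc _ _ _ ⟨
      (st ∙ r k) ∙ r j     ≈⟨ ∙-congʳ (r-suc k) ⟨
      r (suc k) ∙ r j      ∎

    r-sucʳ : ∀ k → r (suc k) ≈ r k ∙ st
    r-sucʳ k = begin
      r (suc k)             ≡⟨ ≡.cong r (ℕ.+-comm 1 k) ⟩
      r (k + 1)             ≈⟨ r-+ k 1 ⟩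
      r k ∙ r 1             ≈⟨ ∙-congˡ (∙-congˡ (identityʳ _)) ⟩
      r k ∙ st              ∎

    module _ (w : Carrier) where
      private
        -- The reflection inverting edge `j`, counted from 0, of the path s t s t ... from `p` is p
        -- (st)^j s p⁻¹; `f p j` tests whether `w` equals it.
        f : Carrier → ℕ → Bool
        f p j = δ (w ∙ p) (p ∙ (r j ∙ gen s))

      f₀ : ∀ p → δ (w ∙ p) (p ∙ gen s) ≡ f p 0
      f₀ p = δ-cong refl (∙-congˡ (sym (identityˡ _)))

      f₁ : ∀ p → δ (w ∙ (p ∙ gen s)) ((p ∙ gen s) ∙ gen t) ≡ f p 1
      f₁ p = ≡.sym (δ-shiftʳ (gen s) (assoc _ _ _) (begin
        (p ∙ (r 1 ∙ gen s)) ∙ gen s   ≈⟨ assoc _ _ _ ⟩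
        p ∙ ((r 1 ∙ gen s) ∙ gen s)   ≈⟨ ∙-congˡ (gen-cancelʳ _ _) ⟩
        p ∙ r 1                       ≈⟨ ∙-congˡ (∙-congˡ (identityʳ _)) ⟩
        p ∙ st                        ≈⟨ assoc _ _ _ ⟨
        (p ∙ gen s) ∙ gen t           ∎))

      f₂ : ∀ p j → f ((p ∙ gen s) ∙ gen t) j ≡ f p (suc (suc j))
      -- Both sides are multiplied on the right by `st`: (st)^(j+2) s (st) = (st)^(j+2) t =
      -- (st)^(j+1) s.
      f₂ p j = ≡.sym (δ-shiftʳ st
        (trans (assoc _ _ _) (∙-congˡ (sym (assoc _ _ _)))) (begin
        (p ∙ (r (2 + j) ∙ gen s)) ∙ st            ≈⟨ assoc _ _ _ ⟩
        p ∙ ((r (2 + j) ∙ gen s) ∙ st)            ≈⟨ ∙-congˡ (assoc _ _ _) ⟩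
        p ∙ (r (2 + j) ∙ (gen s ∙ st))            ≈⟨ ∙-congˡ (∙-congˡ (gen-cancel _ _)) ⟩
        p ∙ (r (2 + j) ∙ gen t)                   ≈⟨ ∙-congˡ (∙-congʳ (r-sucʳ (suc j))) ⟩
        p ∙ ((r (suc j) ∙ st) ∙ gen t)            ≈⟨ ∙-congˡ (assoc _ _ _) ⟩
        p ∙ (r (suc j) ∙ (st ∙ gen t))            ≈⟨ ∙-congˡ (∙-congˡ (gen-cancelʳ _ _)) ⟩
        p ∙ (r (suc j) ∙ gen s)                   ≈⟨ ∙-congˡ (∙-congʳ (r-suc j)) ⟩
        p ∙ ((st ∙ r j) ∙ gen s)                  ≈⟨ ∙-congˡ (assoc _ _ _) ⟩
        p ∙ (st ∙ (r j ∙ gen s))                  ≈⟨ assoc _ _ _ ⟨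
        (p ∙ st) ∙ (r j ∙ gen s)                  ≈⟨ ∙-congʳ (assoc _ _ _) ⟨
        ((p ∙ gen s) ∙ gen t) ∙ (r j ∙ gen s)     ∎))

      cross-power : ∀ k p → cross w (power s t k) p ≡ ⊕ (k + k) (f p)
      cross-power zero    p = ≡.refl
      cross-power (suc k) p = ≡.trans
        (≡.cong₂ _xor_ (f₀ p) (≡.cong₂ _xor_ (f₁ p)
          (≡.trans (cross-power k _) (⊕-cong (k + k) (f₂ p)))))
        (≡.cong (λ n → ⊕ (suc n) (f p)) (≡.sym (ℕ.+-suc k k)))

      -- Since (st)^m = 1, `f p` has period m. The 2m edges of the relator fall into two halves of
      -- equal parity, which cancel.
      cross-relation : ∀ p → cross w (power s t (m s t)) p ≡ false
      cross-relation p = ≡.trans (cross-power n p) (≡.trans (⊕-+ n n (f p))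
        (≡.trans (≡.cong (⊕ n (f p) xor_) (⊕-cong n periodic)) (xor-same (⊕ n (f p)))))
        where
        n = m s t
        r-n : r n ≈ ε
        r-n = Equivalence.from (m-order s t n) ∣-refl
        periodic : ∀ j → f p (n + j) ≡ f p j
        periodic j = δ-cong refl (∙-congˡ (∙-congʳ
          (trans (r-+ n j) (trans (∙-congʳ r-n) (identityˡ _)))))

  ~⇒≈ : ∀ {u v} → m ⊢ u ~ v → eval u ≈ eval v
  ~⇒≈ ~-refl         = refl
  ~⇒≈ (~-sym a)      = sym (~⇒≈ a)
  ~⇒≈ (~-trans a b)  = trans (~⇒≈ a) (~⇒≈ b)
  ~⇒≈ (~-++ {u} {u′} {v} {v′} a b) =
    trans (eval-++ u v) (trans (∙-cong (~⇒≈ a) (~⇒≈ b)) (sym (eval-++ u′ v′)))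
  ~⇒≈ (relation s t) = Equivalence.from (m-order s t (m s t)) ∣-refl

  cross-~ : ∀ t {u v} → m ⊢ u ~ v → ∀ p → cross t u p ≡ cross t v p
  cross-~ t ~-refl         p = ≡.refl
  cross-~ t (~-sym a)      p = ≡.sym (cross-~ t a p)
  cross-~ t (~-trans a b)  p = ≡.trans (cross-~ t a p) (cross-~ t b p)
  cross-~ t (~-++ {u} {u′} {v} {v′} a b) p =
    ≡.trans (cross-++ t u v p) (≡.trans
      (≡.cong₂ _xor_ (cross-~ t a p)
        (≡.trans (cross-~ t b _) (cross-cong t v′ (∙-congˡ (~⇒≈ a)))))
      (≡.sym (cross-++ t u′ v′ p)))
  cross-~ t (relation s s′) p = cross-relation s s′ t p

  -- The presentation makes the parity from `p` depend on the group element alone, so any convenient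
  -- word may be used to compute it.
  cross-eval : ∀ t u v p → eval u ≈ eval v → cross t u p ≡ cross t v p
  cross-eval t u v p e = cross-~ t (presentation u v e) p

-- Applied to the lengths of all elements of the finite group, this stops the climb in `maximum`.
bounded : ∀ {N} (f : Fin N → ℕ) → ∃ λ B → ∀ i → f i ℕ.≤ B
bounded {zero}  f = 0 , λ ()
bounded {suc N} f with bounded (λ i → f (suc i))
... | B , f≤B = f zero + B , λ where
  zero    → ℕ.m≤m+n (f zero) B
  (suc i) → ℕ.≤-trans (f≤B i) (ℕ.m≤n+m B (f zero))

-- The exchange condition.

module Exchange {c ℓ} (𝒲 : FiniteCoxeterSystem c ℓ) where
  open FiniteCoxeterSystem 𝒲
  open Length generatedGroup
  open Crossing 𝒲

  -- One inequality is enough, since `len-≤-length` gives the other.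
  Reduced : Word → Set
  Reduced u = length u ℕ.≤ len (eval u)

  -- Deleting a letter has these two consequences, and no others are used.
  _Shortens_ : Word → Word → Set
  u′ Shortens u = length u′ ℕ.< length u × (∀ {J} → All (_∈ J) u → All (_∈ J) u′)

  -- An odd parity needs some inverted edge. At the first one, from q with label s, t q = q s, so
  -- applying t to the endpoint cancels that letter s.
  crossing-deletes : ∀ t u p → cross t u p ≡ true →
                     ∃ λ u′ → u′ Shortens u × t ∙ (p ∙ eval u) ≈ p ∙ eval u′
  crossing-deletes t (s ∷ u) p c with (t ∙ p) ≟ (p ∙ gen s)
  ... | yes e = u , (ℕ.≤-refl , λ where (_ ∷ a) → a) ,
        trans (sym (assoc _ _ _)) (trans (∙-congʳ e)
          (trans (assoc _ _ _) (∙-congˡ (gen-cancel s (eval u)))))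
  ... | no _ with crossing-deletes t u (p ∙ gen s) c
  ...   | u′ , (l , sub) , e = s ∷ u′ , (s≤s l , λ where (i ∷ a) → i ∷ sub a) ,
          trans (∙-congˡ (sym (assoc _ _ _))) (trans e (assoc _ _ _))

  -- The edge from 1 to s is inverted by s, and the rest of the path `s ∷ u` is the s-translate of
  -- the uncrossed path `u`. So a shortest word of s `eval u` has odd parity too, and deleting a
  -- letter from it yields a shorter word for `eval u`.
  uncrossed-ascends : ∀ s u → cross (gen s) u ε ≡ false →
                      len (eval u) ℕ.< len (gen s ∙ eval u)
  uncrossed-ascends s u c
    with crossing-deletes (gen s) (word (gen s ∙ eval u)) ε crossed
    where
    crossed : cross (gen s) (word (gen s ∙ eval u)) ε ≡ true
    crossed = ≡.trans (cross-eval (gen s) (word (gen s ∙ eval u)) (s ∷ u) ε (eval-word _))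
      (≡.cong₂ _xor_
        (dec-true (_ ≟ _) (trans (identityʳ _) (sym (identityˡ _))))
        (≡.trans (cross-cong (gen s) u (trans (identityˡ _) (sym (identityʳ _))))
          (≡.trans (cross-centraliser (gen s) (gen s) u ε refl) c)))
  ... | u′ , (l , _) , e = ℕ.≤-<-trans (len-≤-length u′ (begin
    eval u′                                       ≈⟨ identityˡ _ ⟨
    ε ∙ eval u′                                   ≈⟨ e ⟨
    gen s ∙ (ε ∙ eval (word (gen s ∙ eval u)))    ≈⟨ ∙-congˡ (identityˡ _) ⟩
    gen s ∙ eval (word (gen s ∙ eval u))          ≈⟨ ∙-congˡ (eval-word _) ⟩
    gen s ∙ (gen s ∙ eval u)                      ≈⟨ gen-cancel s (eval u) ⟩
    eval u                                        ∎)) l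
    where open SetoidReasoning setoid

  -- Parities add over a concatenation: if both factors are even, s ascends; otherwise an odd factor
  -- loses a letter. The factors are kept apart so that each use can exclude one of them.
  exchange : ∀ s u v →
    len (eval u ∙ eval v) ℕ.< len (gen s ∙ (eval u ∙ eval v))
    ⊎ (∃ λ u′ → u′ Shortens u × gen s ∙ eval u ≈ eval u′)
    ⊎ (∃ λ v′ → v′ Shortens v × gen s ∙ (eval u ∙ eval v) ≈ eval u ∙ eval v′)
  exchange s u v with cross (gen s) u ε in cu
  ... | true with crossing-deletes (gen s) u ε cu
  ...   | u′ , short , e = inj₂ (inj₁ (u′ , short ,
          trans (∙-congˡ (sym (identityˡ _))) (trans e (identityˡ _))))
  exchange s u v | false with cross (gen s) v (eval u) in cv
  ... | true  = inj₂ (inj₂ (crossing-deletes (gen s) v (eval u) cv))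
  ... | false = inj₁ (≡.subst₂ ℕ._<_ (len-cong (eval-++ u v)) (len-cong (∙-congˡ (eval-++ u v)))
    (uncrossed-ascends s (u ++ v) (≡.trans (cross-++ (gen s) u v ε)
      (≡.cong₂ _xor_ cu (≡.trans (cross-cong (gen s) v (identityˡ _)) cv)))))

  tail-reduced : ∀ s u → Reduced (s ∷ u) → Reduced u
  tail-reduced s u red = ℕ.≤-pred (ℕ.≤-trans red (len-gen∙ s (eval u)))

  -- Excludes the middle alternative of `exchange` once `s ∷ u` is reduced.
  ¬shorten-reduced : ∀ s u {u′} → Reduced (s ∷ u) → u′ Shortens u → ¬ (gen s ∙ eval u ≈ eval u′)
  ¬shorten-reduced s u {u′} red (l , _) e = ℕ.<-irrefl ≡.refl
    (ℕ.<-≤-trans (ℕ.m<n⇒m<1+n l) (ℕ.≤-trans red (len-≤-length u′ (sym e))))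

-- Parabolic subgroups: reduced words, lower closure and longest elements.

module Parabolic {c ℓ} (𝒲 : FiniteCoxeterSystem c ℓ)
                 (J : List (Fin (FiniteCoxeterSystem.rank 𝒲))) where
  open FiniteCoxeterSystem 𝒲
  open Length generatedGroup
  open Crossing 𝒲 using (cross; cross-++; cross-eval; cross-cong)
  open Exchange 𝒲
  open GroupProperties group using (\\-leftDividesˡ; \\-leftDividesʳ)
  private
    module P = GeneratedGroup (parabolic generatedGroup J)
    module LP = Length (parabolic generatedGroup J)

  W_J : Carrier → Set ℓ
  W_J w = _∈⟨_⟩ generatedGroup w J

  W_J-resp : ∀ {v w} → v ≈ w → W_J v → W_J w
  W_J-resp v≈w (u , u∈J , e) = u , u∈J , trans e v≈w

  W_J-ε : W_J ε
  W_J-ε = proj₂ P.ε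

  W_J-gen : ∀ {s} → s ∈ J → W_J (gen s)
  W_J-gen {s} s∈J = s ∷ [] , s∈J ∷ [] , identityʳ _

  W_J-∙ : ∀ {v w} → W_J v → W_J w → W_J (v ∙ w)
  W_J-∙ {v} {w} v∈ w∈ = proj₂ ((v , v∈) P.∙ (w , w∈))

  W_J-⁻¹∙ : ∀ {v w} → W_J v → W_J w → W_J (v ⁻¹ ∙ w)
  W_J-⁻¹∙ {v} {w} v∈ w∈ = proj₂ ((v , v∈) P.⁻¹ P.∙ (w , w∈))

  -- Letters are prepended one at a time. A descent deletes a letter instead, and the result stays
  -- reduced because s changes the length by at most one.
  reducedIn : ∀ {u} → All (_∈ J) u →
              ∃ λ u′ → All (_∈ J) u′ × eval u′ ≈ eval u × Reduced u′
  reducedIn {[]}    []          = [] , [] , refl , z≤n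
  reducedIn {s ∷ u} (s∈J ∷ u∈J) with reducedIn u∈J
  -- With an empty second word the last alternative of `exchange` cannot occur.
  ... | u′ , u′∈J , e , red with exchange s u′ []
  ...   | inj₁ l = s ∷ u′ , s∈J ∷ u′∈J , ∙-congˡ e , ℕ.≤-<-trans red
            (≡.subst₂ ℕ._<_ (len-cong (identityʳ _)) (len-cong (∙-congˡ (identityʳ _))) l)
  ...   | inj₂ (inj₁ (u″ , (l , sub) , e′)) = u″ , sub u′∈J , trans (sym e′) (∙-congˡ e) ,
          ℕ.≤-pred (ℕ.≤-trans (ℕ.≤-trans l red) (ℕ.≤-trans
            (ℕ.≤-reflexive (len-cong (trans (sym (gen-cancel s (eval u′))) (∙-congˡ e′))))
            (len-gen∙ s (eval u″))))

  reducedWordIn : ∀ {w} → W_J w → ∃ λ u → All (_∈ J) u × eval u ≈ w × Reduced u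
  reducedWordIn (u , u∈J , e) with reducedIn u∈J
  ... | u′ , u′∈J , e′ , red = u′ , u′∈J , trans e′ e , red

  -- An ascent z ⋖ z s makes the reflection z s z⁻¹ cross every word for z s.
  ⋖-closed : ∀ {z x} → z ⋖ x → W_J x → W_J z
  ⋖-closed {z} {x} (s , x≈zs , l) (u , u∈J , u≈x) with crossing-deletes ((z ∙ gen s) ∙ z ⁻¹) u ε crossed
    where
    t = (z ∙ gen s) ∙ z ⁻¹
    tz≈zs : t ∙ z ≈ z ∙ gen s
    tz≈zs = trans (assoc _ _ _) (trans (∙-congˡ (inverseˡ z)) (identityʳ _))
    uncrossed : cross t (word z) ε ≡ false
    uncrossed with cross t (word z) ε in c
    ... | false = ≡.refl
    ... | true with crossing-deletes t (word z) ε c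
    ...   | v , (v<z , _) , e = ⊥-elim (ℕ.<-asym l (ℕ.≤-<-trans (len-≤-length v
              (trans (sym (identityˡ _)) (trans (sym e)
                (trans (∙-congˡ (trans (identityˡ _) (eval-word z)))
                  (trans tz≈zs (sym x≈zs)))))) v<z))
    crossed : cross t u ε ≡ true
    crossed = ≡.trans
      (cross-eval t u (word z ++ s ∷ []) ε
        (trans u≈x (trans x≈zs (sym (trans (eval-++ (word z) _)
          (∙-cong (eval-word z) (identityʳ _)))))))
      (≡.trans (cross-++ t (word z) (s ∷ []) ε) (≡.cong₂ _xor_ uncrossed
        (≡.trans (cross-cong t (s ∷ []) (trans (identityˡ _) (eval-word z)))
          (≡.cong (_xor false) (dec-true (_ ≟ _) tz≈zs)))))
  ... | v , (_ , sub) , e = v , sub u∈J , (begin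
    eval v                              ≈⟨ identityˡ _ ⟨
    ε ∙ eval v                          ≈⟨ e ⟨
    t ∙ (ε ∙ eval u)                    ≈⟨ ∙-congˡ (trans (identityˡ _) (trans u≈x x≈zs)) ⟩
    ((z ∙ gen s) ∙ z ⁻¹) ∙ (z ∙ gen s)  ≈⟨ assoc _ _ _ ⟩
    (z ∙ gen s) ∙ (z ⁻¹ ∙ (z ∙ gen s))  ≈⟨ ∙-congˡ (\\-leftDividesʳ z (gen s)) ⟩
    (z ∙ gen s) ∙ gen s                 ≈⟨ gen-cancelʳ z s ⟩
    z                                   ∎)
    where
    open SetoidReasoning setoid
    t = (z ∙ gen s) ∙ z ⁻¹

  ≤-closed : ∀ {z x} → z ≤ x → W_J x → W_J z
  ≤-closed (≤-equal z≈x)  x∈ = W_J-resp (sym z≈x) x∈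
  ≤-closed (≤-step z⋖y y≤x) x∈ = ⋖-closed z⋖y (≤-closed y≤x x∈)

  module _ {v} (descents : ∀ {s} → s ∈ J → ¬ (len v ℕ.< len (gen s ∙ v))) where

    -- Given v = `eval u` `eval a`, prepending s to `u` must delete a letter of `a`: s does not
    -- ascend from v, and `u` cannot lose a letter because `s ∷ u` is reduced.
    reduced-prefix : ∀ u → All (_∈ J) u → Reduced u →
                     ∃ λ a → length u + length a ℕ.≤ len v × eval u ∙ eval a ≈ v
    reduced-prefix []      _ _ = word v , ℕ.≤-refl , trans (identityˡ _) (eval-word v)
    reduced-prefix (s ∷ u) (s∈J ∷ u∈J) red
      with reduced-prefix u u∈J (tail-reduced s u red)
    ... | a , l , e with exchange s u a
    ...   | inj₁ up = ⊥-elim (descents s∈J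
              (≡.subst₂ ℕ._<_ (len-cong e) (len-cong (∙-congˡ e)) up))
    ...   | inj₂ (inj₁ (u′ , short , e′)) = ⊥-elim (¬shorten-reduced s u red short e′)
    ...   | inj₂ (inj₂ (a′ , (short , _) , e′)) = a′ ,
            ℕ.≤-trans (ℕ.≤-reflexive (≡.sym (ℕ.+-suc (length u) (length a′))))
              (ℕ.≤-trans (ℕ.+-monoʳ-≤ (length u) short) l) ,
            trans (assoc _ _ _) (trans (∙-congˡ (sym e′)) (trans (gen-cancel s _) e))

    descents⇒upperBound : ∀ {w} → W_J w → w ≤ v
    descents⇒upperBound w∈ with reducedWordIn w∈
    ... | u , u∈J , e , red with reduced-prefix u u∈J red
    ...   | a , l , e′ = additive⇒≤ (eval a) (trans (∙-congʳ (sym e)) e′)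
            (ℕ.≤-trans (ℕ.+-mono-≤ (len-≤-length u e) (len-≤-length a refl)) l)

  -- If s ≤ v, then v = s y with lengths adding, so s v = y is no longer than v and
  -- `descents⇒upperBound` applies.
  gens-upperBound : ∀ {v} → (∀ {s} → s ∈ J → gen s ≤ v) → ∀ {w} → W_J w → w ≤ v
  gens-upperBound {v} gens≤v = descents⇒upperBound λ {s} s∈J up →
    let y , sy≈v , l = ≤⇒additive (gens≤v s∈J) in
    ℕ.<⇒≱ up (ℕ.≤-trans
      (ℕ.≤-reflexive (len-cong (trans (∙-congˡ (sym sy≈v)) (gen-cancel s y))))
      (ℕ.≤-trans (ℕ.m≤n+m _ _) l))

  maximum : ∃ λ v → W_J v × (∀ {w} → W_J w → w ≤ v)
  -- The climb multiplies on the left by ascending generators from `J` until none is left. The fuel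
  -- `k` keeps `len v + k` above the bound on all lengths, so it cannot run out.
  maximum = climb (suc (proj₁ bound)) ε W_J-ε (ℕ.m≤n+m _ _)
    where
    open Inverse (proj₂ finite)
    bound = bounded (λ i → len (from i))
    len≤bound : ∀ w → len w ℕ.≤ proj₁ bound
    len≤bound w = ℕ.≤-trans (ℕ.≤-reflexive (len-cong (sym (strictlyInverseʳ w))))
                            (proj₂ bound (to w))
    climb : ∀ k v → W_J v → proj₁ bound ℕ.< len v + k →
            ∃ λ v → W_J v × (∀ {w} → W_J w → w ≤ v)
    climb zero v v∈ l = ⊥-elim (ℕ.<⇒≱ l
      (ℕ.≤-trans (ℕ.≤-reflexive (ℕ.+-identityʳ _)) (len≤bound v)))
    climb (suc k) v v∈ l with any? (λ s → len v ℕ.<? len (gen s ∙ v)) J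
    ... | no none = v , v∈ , descents⇒upperBound (λ s∈J up → none (lose s∈J up))
    ... | yes some with find some
    ...   | s , s∈J , up = climb k (gen s ∙ v) (W_J-∙ (W_J-gen s∈J) v∈)
            (ℕ.≤-trans l (ℕ.≤-trans (ℕ.≤-reflexive (ℕ.+-suc (len v) k)) (ℕ.+-monoˡ-≤ k up)))

  -- Minimal coset representatives and the parabolic part.

  MinimalInCoset : Carrier → Set _
  MinimalInCoset x = ∀ {u} → W_J u → len x ℕ.≤ len (u ∙ x)

  module _ {x} (minimal : MinimalInCoset x) where

    -- In `exchange`, `u` cannot lose a letter since `s ∷ u` is reduced. If the word of x lost one,
    -- u⁻¹ s u x would be an element of the coset `W_J` x shorter than x. Hence every letter
    -- ascends.
    reduced-additive : ∀ u → All (_∈ J) u → Reduced u → length u + len x ℕ.≤ len (eval u ∙ x)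
    reduced-additive []      _ _ = ℕ.≤-reflexive (len-cong (sym (identityˡ x)))
    reduced-additive (s ∷ u) (s∈J ∷ u∈J) red with exchange s u (word x)
    ... | inj₁ up = ℕ.≤-<-trans (reduced-additive u u∈J (tail-reduced s u red))
            (≡.subst₂ ℕ._<_ (len-cong (∙-congˡ (eval-word x)))
              (len-cong (trans (∙-congˡ (∙-congˡ (eval-word x))) (sym (assoc _ _ _)))) up)
    ... | inj₂ (inj₁ (u′ , short , e)) = ⊥-elim (¬shorten-reduced s u red short e)
    ... | inj₂ (inj₂ (v , (short , _) , e)) = ⊥-elim (ℕ.<⇒≱ short
            (ℕ.≤-trans (minimal (W_J-⁻¹∙ (u , u∈J , refl)
                (W_J-∙ (W_J-gen s∈J) (u , u∈J , refl)))) (len-≤-length v (begin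
              eval v                                      ≈⟨ \\-leftDividesʳ (eval u) (eval v) ⟨
              eval u ⁻¹ ∙ (eval u ∙ eval v)               ≈⟨ ∙-congˡ e ⟨
              eval u ⁻¹ ∙ (gen s ∙ (eval u ∙ eval (word x))) ≈⟨ ∙-congˡ (∙-congˡ (∙-congˡ (eval-word x))) ⟩
              eval u ⁻¹ ∙ (gen s ∙ (eval u ∙ x))          ≈⟨ ∙-congˡ (assoc _ _ _) ⟨
              eval u ⁻¹ ∙ ((gen s ∙ eval u) ∙ x)          ≈⟨ assoc _ _ _ ⟨
              (eval u ⁻¹ ∙ (gen s ∙ eval u)) ∙ x          ∎))))
      where open SetoidReasoning setoid

    minimal⇒additive : ∀ {u} → W_J u → len u + len x ℕ.≤ len (u ∙ x)
    minimal⇒additive u∈ with reducedWordIn u∈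
    ... | v , v∈J , e , red = ℕ.≤-trans (ℕ.+-monoˡ-≤ (len x) (len-≤-length v e))
      (ℕ.≤-trans (reduced-additive v v∈J red) (ℕ.≤-reflexive (len-cong (∙-congʳ e))))

  -- The coset W_J x has a minimal element y, and x = u y with u ≠ 1 would make
  -- the first letter of a reduced word of u a descent of x.  The existence of y
  -- is only used inside a proof of falsity, so a descent on lengths suffices.
  noDescent⇒minimal : ∀ {x} → (∀ {s} → s ∈ J → ¬ (len (gen s ∙ x) ℕ.< len x)) → MinimalInCoset x
  noDescent⇒minimal {x} noDescent {u} u∈ = ℕ.≮⇒≥ λ l →
    absurd l (suc (len (ε ∙ x))) ε W_J-ε ℕ.≤-refl
    where
    module _ (l : len (u ∙ x) ℕ.< len x) where
      noMinimal : ∀ v → W_J v → ¬ MinimalInCoset (v ∙ x)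
      noMinimal v v∈ minimal with reducedWordIn (W_J-⁻¹∙ v∈ W_J-ε)
      ... | [] , _ , e , _ = ℕ.<⇒≱ l (ℕ.≤-trans
              (ℕ.≤-reflexive (len-cong (sym vx≈x)))
              (ℕ.≤-trans (minimal u∈) (ℕ.≤-reflexive (len-cong (∙-congˡ vx≈x)))))
        where
        vx≈x : v ∙ x ≈ x
        vx≈x = trans (∙-congʳ (trans (sym (identityʳ v))
          (trans (∙-congˡ e) (\\-leftDividesˡ v ε)))) (identityˡ x)
      ... | s ∷ w , s∈J ∷ w∈J , e , red = noDescent s∈J (begin-strict
        len (gen s ∙ x)                       ≡⟨ len-cong (∙-congˡ (sym swvx≈x)) ⟩
        len (gen s ∙ ((gen s ∙ eval w) ∙ (v ∙ x))) ≡⟨ len-cong (trans (∙-congˡ (assoc _ _ _)) (gen-cancel s _)) ⟩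
        len (eval w ∙ (v ∙ x))                ≤⟨ len-∙ _ _ ⟩
        len (eval w) + len (v ∙ x)            ≤⟨ ℕ.+-monoˡ-≤ _ (len-≤-length w refl) ⟩
        length w + len (v ∙ x)                <⟨ ℕ.≤-refl ⟩
        length (s ∷ w) + len (v ∙ x)          ≤⟨ reduced-additive minimal (s ∷ w) (s∈J ∷ w∈J) red ⟩
        len ((gen s ∙ eval w) ∙ (v ∙ x))      ≡⟨ len-cong swvx≈x ⟩
        len x                                 ∎)
        where
        open ℕ.≤-Reasoning
        swvx≈x : (gen s ∙ eval w) ∙ (v ∙ x) ≈ x
        swvx≈x = trans (∙-congʳ (trans e (identityʳ _))) (\\-leftDividesʳ v x)

      absurd : ∀ n v → W_J v → len (v ∙ x) ℕ.< n → ⊥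
      absurd (suc n) v v∈ (s≤s vx≤n) = noMinimal v v∈ λ {w} w∈ → ℕ.≮⇒≥ λ wvx<vx →
        absurd n (w ∙ v) (W_J-∙ w∈ v∈)
          (ℕ.≤-<-trans (ℕ.≤-reflexive (len-cong (assoc _ _ _))) (ℕ.<-≤-trans wvx<vx vx≤n))

  -- Minimality of `x` in its coset stands in for the maximality of `len v`; it yields that
  -- maximality, uniqueness and the meet property.
  record Decomposition (w : Carrier) : Set (c ⊔ ℓ) where
    field
      {v x}    : Carrier
      v∈W_J    : W_J v
      vx≈w     : v ∙ x ≈ w
      additive : len v + len x ℕ.≤ len w
      minimal  : MinimalInCoset x

  decompose : ∀ w → Decomposition w
  decompose w = strip (suc (len w)) ε w W_J-ε (identityˡ w)
                      (ℕ.≤-reflexive (≡.cong (_+ len w) len-ε)) ℕ.≤-refl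
    where
    -- Left descents in `J` move from x to v: x loses at least one in length and v gains at most
    -- one, which preserves the additivity bound. The fuel exceeds `len x`.
    strip : ∀ k v x → W_J v → v ∙ x ≈ w → len v + len x ℕ.≤ len w → len x ℕ.< k →
            Decomposition w
    strip (suc k) v x v∈ e l (s≤s x≤k) with any? (λ s → len (gen s ∙ x) ℕ.<? len x) J
    ... | no none = record
      { v∈W_J = v∈ ; vx≈w = e ; additive = l
      ; minimal = noDescent⇒minimal (λ s∈J down → none (lose s∈J down)) }
    ... | yes some with find some
    ...   | s , s∈J , down = strip k (v ∙ gen s) (gen s ∙ x)
            (W_J-∙ v∈ (W_J-gen s∈J))
            (trans (assoc _ _ _) (trans (∙-congˡ (gen-cancel s x)) e))
            (ℕ.≤-trans (ℕ.+-monoˡ-≤ _ (len-∙gen v s))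
              (ℕ.≤-trans (ℕ.≤-reflexive (≡.sym (ℕ.+-suc (len v) _)))
                (ℕ.≤-trans (ℕ.+-monoʳ-≤ (len v) down) l)))
            (ℕ.<-≤-trans down x≤k)

  module _ {w} (d : Decomposition w) where
    open Decomposition d

    private
      -- For `v′` in `W_J` this places `x′` in the coset of `x`, where minimality of `x` applies.
      transfer : ∀ {v′ x′} → v′ ∙ x′ ≈ w → (v′ ⁻¹ ∙ v) ∙ x ≈ x′
      transfer {v′} {x′} e = trans (assoc _ _ _)
        (trans (∙-congˡ (trans vx≈w (sym e))) (\\-leftDividesʳ v′ x′))

      additive≡ : len v + len x ≡ len w
      additive≡ = ℕ.≤-antisym additive
        (ℕ.≤-trans (ℕ.≤-reflexive (len-cong (sym vx≈w))) (len-∙ v x))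

    decomposition⇒parabolicPart : IsParabolicPart generatedGroup J w v
    decomposition⇒parabolicPart =
      x , record { inParabolic = v∈W_J ; product = vx≈w ; additive = additive≡ } ,
      λ v′ x′ F → let module F = IsFactorization F in
        ℕ.+-cancelʳ-≤ (len x) _ _ (ℕ.≤-trans
          (ℕ.+-monoʳ-≤ (len v′) (ℕ.≤-trans (minimal (W_J-⁻¹∙ F.inParabolic v∈W_J))
            (ℕ.≤-reflexive (len-cong (transfer F.product)))))
          (ℕ.≤-reflexive (≡.trans F.additive (≡.sym additive≡))))

    -- Maximality of `v′` gives `len x′ ≤ len x`. Since x′ = u x with u = v′⁻¹ v in `W_J` and
    -- lengths adding, u has length 0.
    parabolicPart-unique : ∀ {v′} → IsParabolicPart generatedGroup J w v′ → v′ ≈ v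
    parabolicPart-unique {v′} (x′ , F , max) =
      trans (sym (identityʳ v′)) (trans (∙-congˡ (sym u≈ε)) (\\-leftDividesˡ v′ v))
      where
      module F = IsFactorization F
      u = v′ ⁻¹ ∙ v
      v≤v′ : len v ℕ.≤ len v′
      v≤v′ = max v x (record { inParabolic = v∈W_J ; product = vx≈w ; additive = additive≡ })
      x′≤x : len x′ ℕ.≤ len x
      x′≤x = ℕ.+-cancelˡ-≤ (len v) _ _ (ℕ.≤-trans (ℕ.+-monoˡ-≤ (len x′) v≤v′)
        (ℕ.≤-reflexive (≡.trans F.additive (≡.sym additive≡))))
      u≈ε : u ≈ ε
      u≈ε = len≤0⇒≈ε (ℕ.+-cancelʳ-≤ (len x) _ _ (ℕ.≤-trans
        (minimal⇒additive minimal (W_J-⁻¹∙ F.inParabolic v∈W_J))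
        (ℕ.≤-trans (ℕ.≤-reflexive (len-cong (transfer F.product))) x′≤x)))

    parabolicPart-≤ : v ≤ w
    parabolicPart-≤ = additive⇒≤ x vx≈w additive

    -- Write w = z y with lengths adding. Then y = (z⁻¹ v) x, again with lengths adding, and
    -- cancelling `len x` shows that z is a prefix of v.
    parabolicPart-greatest : ∀ {z} → W_J z → z ≤ w → z ≤ v
    parabolicPart-greatest {z} z∈ z≤w with ≤⇒additive z≤w
    ... | y , zy≈w , l = additive⇒≤ (z ⁻¹ ∙ v) (\\-leftDividesˡ z v)
      (ℕ.+-cancelʳ-≤ (len x) _ _ (begin
        len z + len (z ⁻¹ ∙ v) + len x     ≡⟨ ℕ.+-assoc (len z) _ _ ⟩
        len z + (len (z ⁻¹ ∙ v) + len x)   ≤⟨ ℕ.+-monoʳ-≤ (len z) (minimal⇒additive minimal (W_J-⁻¹∙ z∈ v∈W_J)) ⟩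
        len z + len ((z ⁻¹ ∙ v) ∙ x)       ≡⟨ ≡.cong (len z +_) (len-cong (transfer zy≈w)) ⟩
        len z + len y                      ≤⟨ l ⟩
        len w                              ≡⟨ additive≡ ⟨
        len v + len x                      ∎))
      where open ℕ.≤-Reasoning

  -- Length and weak order of `W_J` compared with those of W.

  private
    eval-lookup : ∀ u → eval (map (lookup J) u) ≈ proj₁ (P.eval u)
    eval-lookup []      = refl
    eval-lookup (i ∷ u) = ∙-congˡ (eval-lookup u)

    indices : ∀ {u} → All (_∈ J) u → ∃ λ v → length v ≡ length u × proj₁ (P.eval v) ≈ eval u
    indices []          = [] , ≡.refl , refl
    indices (s∈J ∷ u∈J) with indices u∈J
    ... | v , l , e = index s∈J ∷ v , ≡.cong suc l ,
      ∙-cong (reflexive (≡.cong gen (≡.sym (lookup-index s∈J)))) e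

  -- `reducedWordIn` supplies words over `J` that are shortest even among words in all generators.
  -- Agreement of the lengths makes the weak order of `W_J` the induced one.
  len-parabolic : ∀ w → P.len w ≡ len (proj₁ w)
  len-parabolic w = ℕ.≤-antisym ≤₁ ≤₂
    where
    ≤₁ : P.len w ℕ.≤ len (proj₁ w)
    ≤₁ with reducedWordIn (proj₂ w)
    ... | u , u∈J , e , red with indices u∈J
    ...   | v , l , e′ = ℕ.≤-trans (LP.len-≤-length v {w} (trans e′ e))
            (ℕ.≤-trans (ℕ.≤-reflexive l) (ℕ.≤-trans red (ℕ.≤-reflexive (len-cong e))))
    ≤₂ : len (proj₁ w) ℕ.≤ P.len w
    ≤₂ = ℕ.≤-trans
      (len-≤-length (map (lookup J) (LP.word w)) (trans (eval-lookup (LP.word w)) (LP.eval-word w)))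
      (ℕ.≤-reflexive (length-map (lookup J) (LP.word w)))

  parabolic-≤⇒≤ : ∀ {v w} → v P.≤ w → proj₁ v ≤ proj₁ w
  parabolic-≤⇒≤ {v} {w} v≤w with LP.≤⇒additive v≤w
  ... | y , e , l = additive⇒≤ (proj₁ y) e (≡.subst₂ ℕ._≤_
    (≡.cong₂ _+_ (len-parabolic v) (len-parabolic y)) (len-parabolic w) l)

  ≤⇒parabolic-≤ : ∀ {v w} → proj₁ v ≤ proj₁ w → v P.≤ w
  ≤⇒parabolic-≤ {v} {w} v≤w with ≤⇒additive v≤w
  ... | y , e , l = LP.additive⇒≤ y′ e (≡.subst₂ ℕ._≤_
    (≡.sym (≡.cong₂ _+_ (len-parabolic v) (len-parabolic y′)))
    (≡.sym (len-parabolic w)) l)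
    where
    y′ : P.Carrier
    y′ = y , W_J-resp (trans (∙-congˡ (sym e)) (\\-leftDividesʳ (proj₁ v) y))
                      (W_J-⁻¹∙ (proj₂ v) (proj₂ w))

-- Surjective lattice homomorphisms from W.

module Homomorphism
  {c ℓ c′ ℓ′} (𝒲 : FiniteCoxeterSystem c ℓ) (W′ : GeneratedGroup c′ ℓ′)
  (η : FiniteCoxeterSystem.Carrier 𝒲 → GeneratedGroup.Carrier W′)
  (hom : IsLatticeHomomorphism (FiniteCoxeterSystem.weakOrder 𝒲) (GeneratedGroup.weakOrder W′) η)
  (surj : Surjective (FiniteCoxeterSystem._≈_ 𝒲) (GeneratedGroup._≈_ W′) η)
  where
  open FiniteCoxeterSystem 𝒲
  open Length generatedGroup
  open IsLatticeHomomorphism hom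
  open IsMeet
  open IsJoin
  private
    module W′ = GeneratedGroup W′
    module L′ = Length W′

  J : List (Fin rank)
  J = nontrivialGens generatedGroup W′ η

  open Parabolic 𝒲 J
  open Decomposition using (v; v∈W_J)
  private
    module P  = GeneratedGroup (parabolic generatedGroup J)
    module LP = Length (parabolic generatedGroup J)

  ∈J⇒η≉ε : ∀ {s} → s ∈ J → ¬ (η (gen s) W′.≈ W′.ε)
  ∈J⇒η≉ε {s} s∈J = proj₂ (∈-filter⁻ (λ s → ¬? (η (gen s) W′.≟ W′.ε)) {xs = allFin rank} s∈J)

  η≉ε⇒∈J : ∀ {s} → ¬ (η (gen s) W′.≈ W′.ε) → s ∈ J
  η≉ε⇒∈J {s} = ∈-filter⁺ (λ s → ¬? (η (gen s) W′.≟ W′.ε)) (∈-allFin s)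

  -- If x ≤ y, then x is the meet of x and y.
  η-mono : ∀ {x y} → x ≤ y → η x W′.≤ η y
  η-mono {x} x≤y = lowerʳ (∧-homo {x} {z = x} record
    { lowerˡ = ≤-equal refl ; lowerʳ = x≤y ; greatest = λ _ w≤x _ → w≤x })

  η-ε : η ε W′.≈ W′.ε
  η-ε with surj W′.ε
  ... | w , ηw≈ = L′.≤ε⇒≈ε (L′.≤-respʳ (ηw≈ refl) (η-mono (ε-minimum w)))

  -- Longest elements of parabolic subgroups and their images.

  module Max K = Parabolic 𝒲 K

  w₀ : List (Fin rank) → Carrier
  w₀ K = proj₁ (Max.maximum K)

  w₀-upper : ∀ K {w} → _∈⟨_⟩ generatedGroup w K → w ≤ w₀ K
  w₀-upper K = proj₂ (proj₂ (Max.maximum K))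

  -- Anything above s and `w₀ K` is above all generators in `s ∷ K`, hence above their whole
  -- parabolic subgroup. This lets `∨-homo` be applied one generator at a time.
  w₀-∷ : ∀ s K → IsJoin weakOrder (gen s) (w₀ K) (w₀ (s ∷ K))
  w₀-∷ s K = record
    { upperˡ = w₀-upper (s ∷ K) (Max.W_J-gen (s ∷ K) (here ≡.refl))
    ; upperʳ = w₀-upper (s ∷ K) (let u , u∈K , e = proj₁ (proj₂ (Max.maximum K)) in
                                 u , All.map there u∈K , e)
    ; least  = λ w s≤w w₀≤w → Max.gens-upperBound (s ∷ K)
        (λ where
          (here ≡.refl) → s≤w
          (there t∈K)   → ≤-trans (w₀-upper K (Max.W_J-gen K t∈K)) w₀≤w)
        (proj₁ (proj₂ (Max.maximum (s ∷ K))))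
    }

  -- Each joined generator either maps to 1′ or belongs to `J` and so lies below `w₀ J`.
  η-w₀-≤ : ∀ K → η (w₀ K) W′.≤ η (w₀ J)
  η-w₀-≤ []      = η-mono (w₀-upper J (let u , u∈[] , e = proj₁ (proj₂ (Max.maximum [])) in
                                       u , All.map (λ ()) u∈[] , e))
  η-w₀-≤ (s ∷ K) = least (∨-homo (w₀-∷ s K)) _ ηs≤ (η-w₀-≤ K)
    where
    ηs≤ : η (gen s) W′.≤ η (w₀ J)
    ηs≤ with η (gen s) W′.≟ W′.ε
    ... | yes ηs≈ε = W′.≤-respˡ ηs≈ε (L′.ε-minimum _)
    ... | no  ηs≉ε = η-mono (w₀-upper J (W_J-gen (η≉ε⇒∈J ηs≉ε)))

  η-w₀-top : ∀ w → η w W′.≤ η (w₀ J)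
  η-w₀-top w = W′.≤-trans
    -- Every element lies in the parabolic subgroup of the full generator list.
    (η-mono (w₀-upper (allFin rank) (word w , All.universal ∈-allFin (word w) , eval-word w)))
    (η-w₀-≤ (allFin rank))

  module _ {w} (d : Decomposition w) where

    parabolicPart-isMeet : IsMeet weakOrder w (w₀ J) (v d)
    parabolicPart-isMeet = record
      { lowerˡ   = parabolicPart-≤ d
      ; lowerʳ   = w₀-upper J (v∈W_J d)
      ; greatest = λ z z≤w z≤w₀ → parabolicPart-greatest d
          (≤-closed z≤w₀ (proj₁ (proj₂ maximum))) z≤w
      }

    η-parabolicPart : η w W′.≈ η (v d)
    η-parabolicPart = W′.≤-antisym
      (greatest (∧-homo parabolicPart-isMeet) _ (W′.≤-equal W′.refl) (η-w₀-top w))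
      (η-mono (parabolicPart-≤ d))

  -- Let y = η(x) be strictly between 1′ and η(a). If a ≤ x, then η(a) ≤ y; so a and x meet in 1,
  -- and y, being below both images, is below η(1) = 1′.
  η-gen-atom : ∀ {a s} → a ≈ gen s → ¬ (η a W′.≈ W′.ε) → IsAtom W′.weakOrder (η a)
  η-gen-atom {a} {s} a≈s ηa≉ε =
    W′.ε , L′.ε-minimum , (L′.ε-minimum _ , λ e → ηa≉ε (W′.sym e)) , between
    where
    between : ∀ y → _
    between y ((_ , ε≉y) , (y≤ηa , y≉ηa)) with surj y
    ... | x , ηx≈y = ε≉y (W′.sym (L′.≤ε⇒≈ε (L′.≤-respʳ η-ε
        (greatest (∧-homo x∧a≈ε) y (W′.≤-equal (W′.sym (ηx≈y refl))) y≤ηa))))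
      where
      a≰x : ¬ (a ≤ x)
      a≰x a≤x = y≉ηa (W′.≤-antisym y≤ηa (L′.≤-respʳ (ηx≈y refl) (η-mono a≤x)))
      x∧a≈ε : IsMeet weakOrder x a ε
      x∧a≈ε = record
        { lowerˡ = ε-minimum x ; lowerʳ = ε-minimum a
        ; greatest = λ z z≤x z≤a → below z z≤x (≤gen⇒ (≤-respʳ a≈s z≤a)) }
        where
        below : ∀ z → z ≤ x → z ≈ ε ⊎ z ≈ gen s → z ≤ ε
        below z z≤x (inj₁ z≈ε) = ≤-equal z≈ε
        below z z≤x (inj₂ z≈s) = ⊥-elim (a≰x (≤-respˡ (trans a≈s (sym z≈s)) z≤x))

  -- Distinct generators meet in 1, so a common image would lie below η(1) = 1′.
  η-gen-injective : ∀ {a b s t} → a ≈ gen s → b ≈ gen t → ¬ (η a W′.≈ W′.ε) →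
                    η a W′.≈ η b → a ≈ b
  η-gen-injective {a} {b} {s} {t} a≈s b≈t ηa≉ε ηa≈ηb with a ≟ b
  ... | yes a≈b = a≈b
  ... | no  a≉b = ⊥-elim (ηa≉ε (L′.≤ε⇒≈ε (L′.≤-respʳ η-ε
      (greatest (∧-homo a∧b≈ε) _ (W′.≤-equal W′.refl) (W′.≤-equal ηa≈ηb)))))
    where
    a∧b≈ε : IsMeet weakOrder a b ε
    a∧b≈ε = record
      { lowerˡ = ε-minimum a ; lowerʳ = ε-minimum b
      ; greatest = λ z z≤a z≤b → below z (≤gen⇒ (≤-respʳ a≈s z≤a)) (≤gen⇒ (≤-respʳ b≈t z≤b)) }
      where
      below : ∀ z → z ≈ ε ⊎ z ≈ gen s → z ≈ ε ⊎ z ≈ gen t → z ≤ ε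
      below z (inj₁ z≈ε) _          = ≤-equal z≈ε
      below z _          (inj₁ z≈ε) = ≤-equal z≈ε
      below z (inj₂ z≈s) (inj₂ z≈t) =
        ⊥-elim (a≉b (trans a≈s (trans (sym z≈s) (trans z≈t (sym b≈t)))))

  -- The factorization and the restriction to `W_J`.

  parabolicMap : ∃ λ ηJ → IsParabolicMap generatedGroup J ηJ
  parabolicMap = (λ w → v (decompose w) , v∈W_J (decompose w)) ,
                 (λ w → decomposition⇒parabolicPart (decompose w))

  -- Uniqueness of the parabolic part carries `η-parabolicPart` from the constructed decomposition
  -- to any `ηJ`.
  factors : ∀ ηJ → IsParabolicMap generatedGroup J ηJ →
            ∀ w → η w W′.≈ restrict generatedGroup J η (ηJ w)
  factors ηJ isMap w = W′.trans (η-parabolicPart (decompose w))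
    (cong (sym (parabolicPart-unique (decompose w) (isMap w))))

  η∣J : P.Carrier → W′.Carrier
  η∣J = restrict generatedGroup J η

  -- `W_J` is a lower set, so every lower bound in W is already in it.
  meet⇒meet : ∀ {x y z} → IsMeet P.weakOrder x y z → IsMeet weakOrder (proj₁ x) (proj₁ y) (proj₁ z)
  meet⇒meet {x} {y} {z} μ = record
    { lowerˡ   = parabolic-≤⇒≤ (lowerˡ μ)
    ; lowerʳ   = parabolic-≤⇒≤ (lowerʳ μ)
    ; greatest = λ w w≤x w≤y → parabolic-≤⇒≤ (greatest μ (w , ≤-closed w≤x (proj₂ x))
                   (≤⇒parabolic-≤ w≤x) (≤⇒parabolic-≤ w≤y))
    }

  -- An upper bound w in W may leave `W_J`, but its parabolic part is still above x and y, hence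
  -- above their join in `W_J`.
  join⇒join : ∀ {x y z} → IsJoin P.weakOrder x y z → IsJoin weakOrder (proj₁ x) (proj₁ y) (proj₁ z)
  join⇒join {x} {y} {z} μ = record
    { upperˡ = parabolic-≤⇒≤ (upperˡ μ)
    ; upperʳ = parabolic-≤⇒≤ (upperʳ μ)
    ; least  = λ w x≤w y≤w → let d = decompose w in
        ≤-trans (parabolic-≤⇒≤ (least μ (v d , v∈W_J d)
                  (≤⇒parabolic-≤ (parabolicPart-greatest d (proj₂ x) x≤w))
                  (≤⇒parabolic-≤ (parabolicPart-greatest d (proj₂ y) y≤w))))
                (parabolicPart-≤ d)
    }

  restriction-isLatticeHomomorphism : IsLatticeHomomorphism P.weakOrder W′.weakOrder η∣J
  restriction-isLatticeHomomorphism = record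
    { cong   = cong
    ; ∧-homo = λ μ → ∧-homo (meet⇒meet μ)
    ; ∨-homo = λ μ → ∨-homo (join⇒join μ)
    }

  restriction-surjective : Surjective P._≈_ W′._≈_ η∣J
  restriction-surjective y = let x , ηx≈y = surj y
                                 d = decompose x in
    (v d , v∈W_J d) , λ z≈v → W′.trans (cong z≈v)
      (W′.trans (W′.sym (η-parabolicPart d)) (ηx≈y refl))

  parabolicAtom : ∀ {a} → IsAtom P.weakOrder a → ∃ λ s → s ∈ J × proj₁ a ≈ gen s
  parabolicAtom a-atom = let i , a≈ = LP.atom⇒gen a-atom in lookup J i , ∈-lookup i , a≈

  parabolicAtom-nontrivial : ∀ {a} → IsAtom P.weakOrder a → ¬ (η∣J a W′.≈ W′.ε)
  parabolicAtom-nontrivial a-atom ηa≈ε = let s , s∈J , a≈s = parabolicAtom a-atom in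
    ∈J⇒η≉ε s∈J (W′.trans (cong (sym a≈s)) ηa≈ε)

  gen-parabolicAtom : ∀ {s} (s∈J : s ∈ J) → IsAtom P.weakOrder (gen s , W_J-gen s∈J)
  gen-parabolicAtom {s} s∈J =
    LP.gen-isAtom (index s∈J) (reflexive (≡.cong gen (lookup-index s∈J))) (gen-nontrivial s)

  -- A preimage of b in `W_J` is not 1, so its reduced word starts with some s in `J`. Then η(s) ≤ b
  -- and η(s) ≠ 1′, which forces equality because b is an atom.
  restriction-atom-surjective : ∀ {b} → IsAtom W′.weakOrder b →
                                ∃ λ a → IsAtom P.weakOrder a × η∣J a W′.≈ b
  restriction-atom-surjective {b} b-atom with restriction-surjective b
  ... | x , ηx≈b with reducedWordIn (proj₂ x)
  ...   | [] , _ , ε≈x , _ = ⊥-elim (L′.atom-nontrivial b-atom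
          (W′.trans (W′.sym (ηx≈b {x} refl)) (W′.trans (cong (sym ε≈x)) η-ε)))
  ...   | s ∷ u , s∈J ∷ _ , su≈x , red = (gen s , W_J-gen s∈J) , gen-parabolicAtom s∈J , ηs≈b
    where
    ηs≤b : η (gen s) W′.≤ b
    ηs≤b = L′.≤-respʳ (ηx≈b {x} refl) (η-mono (additive⇒≤ (eval u) su≈x
      (ℕ.≤-trans (ℕ.+-mono-≤ (len-gen s) (len-≤-length u refl))
        (ℕ.≤-trans red (ℕ.≤-reflexive (len-cong su≈x))))))
    ηs≈b : η (gen s) W′.≈ b
    ηs≈b with L′.atom⇒gen b-atom
    ... | t , b≈t with L′.≤gen⇒ (L′.≤-respʳ b≈t ηs≤b)
    ...   | inj₁ ηs≈ε = ⊥-elim (∈J⇒η≉ε s∈J ηs≈ε)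
    ...   | inj₂ ηs≈t = W′.trans ηs≈t (W′.sym b≈t)

  restriction-isCompressive : IsCompressive P.weakOrder W′.weakOrder η∣J
  restriction-isCompressive = record
    { isLatticeHomomorphism = restriction-isLatticeHomomorphism
    ; surjective            = restriction-surjective
    ; atom                  = λ a-atom → η-gen-atom
        (proj₂ (proj₂ (parabolicAtom a-atom))) (parabolicAtom-nontrivial a-atom)
    ; atom-injective        = λ a-atom b-atom → η-gen-injective
        (proj₂ (proj₂ (parabolicAtom a-atom))) (proj₂ (proj₂ (parabolicAtom b-atom)))
        (parabolicAtom-nontrivial a-atom)
    ; atom-surjective       = restriction-atom-surjective
    }

theorem1p5 : ∀ {c ℓ c′ ℓ′} (𝒲 : FiniteCoxeterSystem c ℓ) (𝒲′ : FiniteCoxeterSystem c′ ℓ′) →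
  let module W  = FiniteCoxeterSystem 𝒲
      module W′ = FiniteCoxeterSystem 𝒲′ in
  (η : W.Carrier → W′.Carrier) →
  IsLatticeHomomorphism W.weakOrder W′.weakOrder η →
  Surjective W._≈_ W′._≈_ η →
  let J        = nontrivialGens W.generatedGroup W′.generatedGroup η
      module P = GeneratedGroup (parabolic W.generatedGroup J)
      η∣J      = restrict W.generatedGroup J η in
  (∃ λ ηJ → IsParabolicMap W.generatedGroup J ηJ)
  × (∀ ηJ → IsParabolicMap W.generatedGroup J ηJ → ∀ w → η w W′.≈ η∣J (ηJ w))
  × IsCompressive P.weakOrder W′.weakOrder η∣J
theorem1p5 𝒲 𝒲′ η hom surj = parabolicMap , factors , restriction-isCompressive
  where
  open Homomorphism 𝒲 (FiniteCoxeterSystem.generatedGroup 𝒲′) η hom surj
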